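{- Let $G$ be a group, $X$ a topological space, $\mathcal{M}$ a sheaf of G-structures on $X$, $\mathbb{F}$ a generic filter on $X$ with respect to $\mathcal{M}$, and $\mathcal{M}^{\mathrm{gen}}=\operatorname{coLim}_{U\in\mathbb{F}}\mathcal{M}_U$ the induced generic model. For each formula $\varphi(\mathbf v)$, each $U\in\mathbb{F}$ and each tuple $\mathbf a$ from $\mathcal{M}_U$, the following are equivalent: (1) $\mathcal{M}^{\mathrm{gen}}\models\varphi([\mathbf a])$; (2) $\mathcal{M}\Vdash_V\varphi_{\mathbb{G}}(\mathbf a)$ for some $V\in\mathbb{F}$ with $V\subset U$; (3) $\{x\in U:\mathcal{M}\Vdash_x\varphi_{\mathbb{G}}(\mathbf a)\}\in\mathbb{F}$.
   Context: G-structure: for a group $G$ and language $\mathcal{L}=(\mathcal{F},\mathcal{R},\mathcal{C})$, an $\mathcal{L}$-structure with a $G$-action on its universe such that the set of constant interpretations is $G$-invariant, each relation $R^{\mathcal{M}}$ is invariant under $(x_1,\dots,x_n)\mapsto(g_1x_1,\dots,g_nx_n)$ for arbitrary $g_k\in G$, and $f^{\mathcal{M}}(gx_1,\dots,gx_n)=gf^{\mathcal{M}}(x_1,\dots,x_n)$; morphisms of G-structures are $G$-equivariant maps commuting with functions and constants and mapping each $R^{\mathcal{M}}$ into $R^{\mathcal{N}}$. A presheaf of G-structures on $X$ assigns to each open $U$ a G-structure $\mathcal{M}_U$ and to each inclusion $U\subset V$ a morphism $\rho_{UV}:\mathcal{M}_V\to\mathcal{M}_U$ with $\rho_{UU}=\mathrm{id}$,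 $\rho_{UV}\rho_{VW}=\rho_{UW}$. It is a sheaf if for every family of open $U_i$ with union $U$: (coherence) $s,s'\in\mathcal{M}_U$ with equal restrictions to all $U_i$ are equal; (exactness) elements $s_i\in\mathcal{M}_{U_i}$ agreeing after restriction on every nonempty $U_i\cap U_j$ come from some $s\in\mathcal{M}_U$. Point forcing: for $x\in U$ open, $\mathbf a$ in $\mathcal{M}_U$: (1) if $\varphi$ contains no $\neg,\forall$: $\mathcal{M}\Vdash_x\varphi(\mathbf a)$ iff there is open $V$, $x\in V\subset U$, with $\mathcal{M}_V\models\varphi(\rho_{UV}(\mathbf a))$; (2) $\neg\psi$: iff there is open $V$, $x\in V\subset U$, with $\mathcal{M}\not\Vdash_y\psi(\mathbf a)$ for all $y\in V$; (3) $\psi\to\nu$: iff there is open $V\ni x$, $V\subset U$, such that for all $y\in V$, $\mathcal{M}\Vdash_y\psi(\mathbf a)$ implies $\mathcal{M}\Vdash_y\nu(\mathbf a)$; (4) $\forall w\,\psi$: iff there is open $V\ni x$, $V\subset U$, with $\mathcal{M}\Vdash_y\psi(\rho_{UV}(\mathbf a),b)$ for all $y\in V$, $b\in\mathcal{M}_V$; otherwise $\wedge$, $\vee$ are componentwise and $\exists w\,\psi$ is forced iff some open $V\ni x$, $V\subset U$, and $b\in\mathcal{M}_V$ satisfy $\mathcal{M}\Vdash_x\psi(\rho_{UV}(\mathbf a),b)$. Open forcing: $\mathcal{M}\Vdash_V\varphi(\mathbf a)$ iff $\mathcal{M}\Vdash_x\varphi(\mathbf a)$ for all $x\in V$ (with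 $\mathbf a$ restricted to $V$). A filter in $X$ is a family $\mathbb{F}$ of open sets closed under finite intersections and open supersets; nontrivial iff $\emptyset\notin\mathbb{F}$. A nontrivial filter is generic w.r.t. $\mathcal{M}$ iff (i) for every formula $\varphi(\mathbf v)$, $U\in\mathbb{F}$, $\mathbf a\in\mathcal{M}_U^n$ there is $V\in\mathbb{F}$, $V\subset U$, with $\mathcal{M}\Vdash_V\varphi(\mathbf a)$ or $\mathcal{M}\Vdash_V\neg\varphi(\mathbf a)$; (ii) whenever $\mathcal{M}\Vdash_U\exists\mathbf w\,\varphi(\mathbf a,\mathbf w)$ with $U\in\mathbb{F}$, there are $V\in\mathbb{F}$, $V\subset U$, and $\mathbf b\in\mathcal{M}_V^m$ with $\mathcal{M}\Vdash_V\varphi(\mathbf a,\mathbf b)$. Generic model: $\mathcal{M}^{\mathrm{gen}}$ is the colimit of the structures $\mathcal{M}_U$, $U\in\mathbb{F}$, along the restriction maps (directed by reverse inclusion): universe $\bigsqcup_{U\in\mathbb{F}}\mathcal{M}_U/\sim$ with $x\in\mathcal{M}_U$, $y\in\mathcal{M}_{U'}$ identified iff they have equal restrictions to some $W\in\mathbb{F}$, $W\subset U\cap U'$; functions, constants act on germs via representatives, and a germ tuple $[\mathbf x]$ lies in $R^{\mathcal{M}^{\mathrm{gen}}}$ iff some representative lies in $R^{\mathcal{M}_W}$; $[\mathbf a]$ is the germ of $\mathbf a$. Gödel translation $\varphi_{\mathbb{G}}$: $\varphi_{\mathbb{G}}=\neg\neg\varphi$ for atomic $\varphi$; $(\varphi\wedge\psi)_{\mathbb{G}}=\varphi_{\mathbb{G}}\wedge\psi_{\mathbb{G}}$;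 $(\varphi\vee\psi)_{\mathbb{G}}=\neg(\neg\varphi_{\mathbb{G}}\wedge\neg\psi_{\mathbb{G}})$; $(\neg\varphi)_{\mathbb{G}}=\neg\varphi_{\mathbb{G}}$; $(\forall v\,\varphi)_{\mathbb{G}}=\forall v\,\varphi_{\mathbb{G}}$; $(\exists v\,\varphi)_{\mathbb{G}}=\neg\forall v\,\neg\varphi_{\mathbb{G}}$.
   Formalization: Two corrections, as the claim fails otherwise: in the forcing clause for ∀, b ranges over sections on all open W⊂V, not only b in M_V; and the sheaf condition also requires that a relation holding on every member of an open cover of U holds on U. -}

module Defs where

open import Algebra.Bundles using (Group)
open import Data.Bool.Base using (Bool; true; false; if_then_else_) renaming (_∧_ to _and_)
open import Data.Fin.Base using (Fin; zero; suc)
open import Data.Nat.Base using (ℕ; zero; suc; _+_)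
open import Data.Product.Base using (Σ; ∃; _×_; _,_; proj₁; proj₂)
open import Data.Sum.Base using (_⊎_)
open import Data.Unit.Polymorphic.Base using (⊤)
open import Data.Vec.Functional using (Vector; _∷_; _++_)
open import Function.Base using (_∘_)
open import Level using (Level) renaming (suc to lsuc; _⊔_ to _⊔ˡ_)
open import Relation.Binary.Bundles using (Setoid)
open import Relation.Nullary.Negation.Core using (¬_)
open import Relation.Unary using (Pred; _∈_; _∩_; _⊆′_; _≐′_; ⋃; Satisfiable; Empty)
import Relation.Binary.Reasoning.Setoid as ≈-Reasoning

-- Spaces, groups, languages and section structures live at level ℓ;
-- families of subsets live at level suc ℓ.  A union over a family
-- indexed at level suc ℓ is not literally a predicate at level ℓ, so
-- ⋃-open provides an open set with the same points as the union.  The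
-- empty set is open as the union of the empty family.

record TopologicalSpace (ℓ : Level) : Set (lsuc (lsuc ℓ)) where
  field
    Point       : Set ℓ
    IsOpen      : Pred (Pred Point ℓ) (lsuc ℓ)
    open-resp-≐ : ∀ {P Q} → P ≐′ Q → IsOpen P → IsOpen Q
    whole-open  : IsOpen (λ _ → ⊤)
    ∩-open      : ∀ {P Q} → IsOpen P → IsOpen Q → IsOpen (P ∩ Q)
    ⋃-open      : ∀ {I : Set (lsuc ℓ)} (P : I → Pred Point ℓ) →
                  (∀ i → IsOpen (P i)) →
                  ∃ λ Q → IsOpen Q × Q ≐′ ⋃ I P

  record Open : Set (lsuc ℓ) where
    constructor mkOpen
    field
      points : Pred Point ℓ
      isOpen : IsOpen points

  open Open public

  infix 4 _⊑_
  infixr 7 _⊓_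

  record _⊑_ (U V : Open) : Set ℓ where
    constructor incl
    field
      ⊑⇒⊆ : points U ⊆′ points V

  open _⊑_ public

  whole : Open
  whole = mkOpen (λ _ → ⊤) whole-open

  _⊓_ : Open → Open → Open
  U ⊓ V = mkOpen (points U ∩ points V) (∩-open (isOpen U) (isOpen V))

  ⊑-refl : ∀ {U} → U ⊑ U
  ⊑-refl = incl λ _ x∈U → x∈U

  ⊑-trans : ∀ {U V W} → U ⊑ V → V ⊑ W → U ⊑ W
  ⊑-trans p q = incl λ x x∈U → ⊑⇒⊆ q x (⊑⇒⊆ p x x∈U)

  ⊓⊑ˡ : ∀ {U V} → U ⊓ V ⊑ U
  ⊓⊑ˡ = incl λ _ → proj₁

  ⊓⊑ʳ : ∀ {U V} → U ⊓ V ⊑ V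
  ⊓⊑ʳ = incl λ _ → proj₂

record Language (ℓ : Level) : Set (lsuc ℓ) where
  field
    Fun      : Set ℓ
    Rel      : Set ℓ
    Con      : Set ℓ
    funArity : Fun → ℕ
    relArity : Rel → ℕ

module Syntax {ℓ} (L : Language ℓ) where
  open Language L

  data Term (n : ℕ) : Set ℓ where
    var : Fin n → Term n
    con : Con → Term n
    fun : (f : Fun) → Vector (Term n) (funArity f) → Term n

  infix  8 _≈′_
  infixr 7 _∧′_
  infixr 6 _∨′_
  infixr 5 _⇒′_

  -- Formula n has its free variables among n de Bruijn indices; index
  -- zero is the variable bound by the nearest quantifier.
  data Formula : ℕ → Set ℓ where
    _≈′_ : ∀ {n} → Term n → Term n → Formula n
    rel  : ∀ {n} (R : Rel) → Vector (Term n) (relArity R) → Formula n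
    ¬′_  : ∀ {n} → Formula n → Formula n
    _∧′_ : ∀ {n} → Formula n → Formula n → Formula n
    _∨′_ : ∀ {n} → Formula n → Formula n → Formula n
    _⇒′_ : ∀ {n} → Formula n → Formula n → Formula n
    ∀′_  : ∀ {n} → Formula (suc n) → Formula n
    ∃′_  : ∀ {n} → Formula (suc n) → Formula n

  ∃^ : ∀ m {n} → Formula (m + n) → Formula n
  ∃^ zero    φ = φ
  ∃^ (suc m) φ = ∃^ m (∃′ φ)

  -- Implication has a forcing clause of its own, so it is excluded here
  -- along with negation and universal quantification.
  positive : ∀ {n} → Formula n → Bool
  positive (s ≈′ t)   = true
  positive (rel R ts) = true
  positive (¬′ φ)     = false
  positive (φ ∧′ ψ)   = positive φ and positive ψ
  positive (φ ∨′ ψ)   = positive φ and positive ψ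
  positive (φ ⇒′ ψ)   = false
  positive (∀′ φ)     = false
  positive (∃′ φ)     = positive φ

  -- The translation commutes with ⇒ as it does with ∧, ¬ and ∀.
  gödel : ∀ {n} → Formula n → Formula n
  gödel (s ≈′ t)   = ¬′ ¬′ (s ≈′ t)
  gödel (rel R ts) = ¬′ ¬′ rel R ts
  gödel (¬′ φ)     = ¬′ gödel φ
  gödel (φ ∧′ ψ)   = gödel φ ∧′ gödel ψ
  gödel (φ ∨′ ψ)   = ¬′ (¬′ gödel φ ∧′ ¬′ gödel ψ)
  gödel (φ ⇒′ ψ)   = gödel φ ⇒′ gödel ψ
  gödel (∀′ φ)     = ∀′ gödel φ
  gödel (∃′ φ)     = ¬′ ∀′ ¬′ gödel φ

-- The universe is a setoid because the generic model is a quotient.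
record Structure {ℓ} (L : Language ℓ) (s : Level) : Set (ℓ ⊔ˡ lsuc s) where
  open Language L
  field
    setoid : Setoid s s
  open Setoid setoid public
  field
    funᴵ      : (f : Fun) → Vector Carrier (funArity f) → Carrier
    funᴵ-cong : ∀ f {xs ys} → (∀ i → xs i ≈ ys i) → funᴵ f xs ≈ funᴵ f ys
    relᴵ      : (R : Rel) → Pred (Vector Carrier (relArity R)) s
    relᴵ-resp : ∀ R {xs ys} → (∀ i → xs i ≈ ys i) → relᴵ R xs → relᴵ R ys
    conᴵ      : Con → Carrier

module Semantics {ℓ s} {L : Language ℓ} (A : Structure L s) where
  open Structure A
  open Syntax L

  eval : ∀ {n} → Term n → Vector Carrier n → Carrier
  eval (var i)    a = a i
  eval (con c)    a = conᴵ c
  eval (fun f ts) a = funᴵ f (λ i → eval (ts i) a)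

  infix 4 ⊨_[_]

  ⊨_[_] : ∀ {n} → Formula n → Vector Carrier n → Set s
  ⊨ s ≈′ t   [ a ] = eval s a ≈ eval t a
  ⊨ rel R ts [ a ] = relᴵ R (λ i → eval (ts i) a)
  ⊨ ¬′ φ     [ a ] = ¬ ⊨ φ [ a ]
  ⊨ φ ∧′ ψ   [ a ] = ⊨ φ [ a ] × ⊨ ψ [ a ]
  ⊨ φ ∨′ ψ   [ a ] = ⊨ φ [ a ] ⊎ ⊨ ψ [ a ]
  ⊨ φ ⇒′ ψ   [ a ] = ⊨ φ [ a ] → ⊨ ψ [ a ]
  ⊨ ∀′ φ     [ a ] = ∀ b → ⊨ φ [ b ∷ a ]
  ⊨ ∃′ φ     [ a ] = ∃ λ b → ⊨ φ [ b ∷ a ]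

infix 4 _⊨_[_]

_⊨_[_] : ∀ {ℓ s} {L : Language ℓ} (A : Structure L s) {n : ℕ} →
         Syntax.Formula L n → Vector (Structure.Carrier A) n → Set s
A ⊨ φ [ a ] = Semantics.⊨_[_] A φ a

record GStructure {ℓ} (G : Group ℓ ℓ) (L : Language ℓ) (s : Level) :
                  Set (ℓ ⊔ˡ lsuc s) where
  private module G = Group G
  open Language L
  field
    structure : Structure L s
  open Structure structure public
  infixr 7 _•_
  field
    _•_    : G.Carrier → Carrier → Carrier
    •-cong : ∀ {g h x y} → g G.≈ h → x ≈ y → g • x ≈ h • y
    ε-•    : ∀ x → G.ε • x ≈ x
    ∙-•    : ∀ g h x → (g G.∙ h) • x ≈ g • h • x
    con-invariant   : ∀ g c → ∃ λ c′ → g • conᴵ c ≈ conᴵ c′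
    rel-invariant   : ∀ R (g : Vector G.Carrier (relArity R)) xs →
                      relᴵ R xs → relᴵ R (λ i → g i • xs i)
    fun-equivariant : ∀ f g xs → funᴵ f (λ i → g • xs i) ≈ g • funᴵ f xs

record GMorphism {ℓ s} {G : Group ℓ ℓ} {L : Language ℓ}
                 (A B : GStructure G L s) : Set (ℓ ⊔ˡ s) where
  private
    module A = GStructure A
    module B = GStructure B
  open Language L
  field
    to          : A.Carrier → B.Carrier
    cong        : ∀ {x y} → x A.≈ y → to x B.≈ to y
    equivariant : ∀ g x → to (g A.• x) B.≈ g B.• to x
    fun-homo    : ∀ f xs → to (A.funᴵ f xs) B.≈ B.funᴵ f (to ∘ xs)
    con-homo    : ∀ c → to (A.conᴵ c) B.≈ B.conᴵ c
    rel-homo    : ∀ R xs → A.relᴵ R xs → B.relᴵ R (to ∘ xs)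

module _ {ℓ} (G : Group ℓ ℓ) (L : Language ℓ) (X : TopologicalSpace ℓ) where
  open TopologicalSpace X

  -- The laws range over all inclusion proofs, so a restriction map
  -- depends only on the two open sets.
  record Presheaf : Set (lsuc ℓ) where
    field
      section : Open → GStructure G L ℓ
      ρ       : ∀ {U V} → U ⊑ V → GMorphism (section V) (section U)

    module Sec (U : Open) = GStructure (section U)

    res : ∀ {U V} → U ⊑ V → Sec.Carrier V → Sec.Carrier U
    res p = GMorphism.to (ρ p)

    field
      ρ-id   : ∀ {U} (p : U ⊑ U) s → Sec._≈_ U (res p s) s
      ρ-comp : ∀ {U V W} (p : U ⊑ V) (q : V ⊑ W) (r : U ⊑ W) s →
               Sec._≈_ U (res p (res q s)) (res r s)

    infixl 8 _↾_

    _↾_ : ∀ {n U V} → Vector (Sec.Carrier V) n → U ⊑ V → Vector (Sec.Carrier U) n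
    (a ↾ p) i = res p (a i)

module _ {ℓ} {G : Group ℓ ℓ} {L : Language ℓ} {X : TopologicalSpace ℓ}
         (M : Presheaf G L X) where
  open TopologicalSpace X
  open Presheaf M
  open Syntax L

  -- The sheaf condition is imposed on the relations as well as on the
  -- elements, so that M_U is the limit of the M_{U_i} as a structure:
  -- without rel-exactness a relation could hold on every member of a cover
  -- of U but fail on U, and so be forced on U and yet fail in the generic
  -- model of a filter containing no smaller open set.  For example, let X
  -- be two discrete points, every M_U a single element, R true on M_U for
  -- U ≠ X and false on M_X; then {X} is a generic filter.
  record IsSheaf : Set (lsuc (lsuc ℓ)) where
    field
      coherence : ∀ {I : Set (lsuc ℓ)} {V : I → Open} {U : Open}
        (cover : points U ≐′ ⋃ I (points ∘ V)) (p : ∀ i → V i ⊑ U)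
        (s s′ : Sec.Carrier U) →
        (∀ i → Sec._≈_ (V i) (res (p i) s) (res (p i) s′)) →
        Sec._≈_ U s s′
      exactness : ∀ {I : Set (lsuc ℓ)} {V : I → Open} {U : Open}
        (cover : points U ≐′ ⋃ I (points ∘ V)) (p : ∀ i → V i ⊑ U)
        (s : ∀ i → Sec.Carrier (V i)) →
        (∀ i j → Satisfiable (points (V i ⊓ V j)) →
          Sec._≈_ (V i ⊓ V j) (res ⊓⊑ˡ (s i)) (res ⊓⊑ʳ (s j))) →
        ∃ λ t → ∀ i → Sec._≈_ (V i) (res (p i) t) (s i)
      rel-exactness : ∀ {I : Set (lsuc ℓ)} {V : I → Open} {U : Open}
        (cover : points U ≐′ ⋃ I (points ∘ V)) (p : ∀ i → V i ⊑ U)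
        (R : Language.Rel L) (s : Vector (Sec.Carrier U) (Language.relArity L R)) →
        (∀ i → Sec.relᴵ (V i) R (s ↾ p i)) → Sec.relᴵ U R s

  HoldsNear : ∀ {n} → Formula n → (U : Open) → Vector (Sec.Carrier U) n →
              Pred Point (lsuc ℓ)
  HoldsNear φ U a x =
    ∃ λ V → x ∈ points V × Σ (V ⊑ U) λ p → Sec.structure V ⊨ φ [ a ↾ p ]

  -- Forces φ U a x is  M ⊩ₓ φ(a)  for a tuple a of sections over U.  Every
  -- clause implies x ∈ U.
  --
  -- In the clause for ∀ the parameter b ranges over the sections over all
  -- open W ⊑ V, at the points y of W.  Allowing only b ∈ M_V would make
  -- forcing depend on U rather than on the germ of a at x, because a
  -- section over W need not extend to V.  For example, on the Sierpiński
  -- space with open point η put M_X = {c}, M_{η} = {c, d} and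
  -- R = {c} on both.  With b ∈ M_V only, ∀w R(w) and ∀w ¬¬R(w) would be
  -- forced at η over X, but not over {η}, and not be true in the generic
  -- model of the filter { {η}, X }, which is M_{η}.
  Forces : ∀ {n} → Formula n → (U : Open) → Vector (Sec.Carrier U) n →
           Pred Point (lsuc ℓ)
  Forces (s ≈′ t)   U a x = HoldsNear (s ≈′ t) U a x
  Forces (rel R ts) U a x = HoldsNear (rel R ts) U a x
  Forces (¬′ φ)     U a x =
    ∃ λ V → x ∈ points V × V ⊑ U × (∀ y → y ∈ points V → ¬ Forces φ U a y)
  Forces (φ ∧′ ψ)   U a x =
    if positive (φ ∧′ ψ) then HoldsNear (φ ∧′ ψ) U a x
    else (Forces φ U a x × Forces ψ U a x)
  Forces (φ ∨′ ψ)   U a x =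
    if positive (φ ∨′ ψ) then HoldsNear (φ ∨′ ψ) U a x
    else (Forces φ U a x ⊎ Forces ψ U a x)
  Forces (φ ⇒′ ψ)   U a x =
    ∃ λ V → x ∈ points V × V ⊑ U ×
      (∀ y → y ∈ points V → Forces φ U a y → Forces ψ U a y)
  Forces (∀′ φ)     U a x =
    ∃ λ V → x ∈ points V × Σ (V ⊑ U) λ p →
      ∀ W (q : W ⊑ V) y → y ∈ points W → (b : Sec.Carrier W) →
      Forces φ W (b ∷ (a ↾ ⊑-trans q p)) y
  Forces (∃′ φ)     U a x =
    if positive (∃′ φ) then HoldsNear (∃′ φ) U a x
    else (∃ λ V → x ∈ points V × Σ (V ⊑ U) λ p →
          ∃ λ (b : Sec.Carrier V) → Forces φ V (b ∷ (a ↾ p)) x)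

  OpenForces : ∀ {n} → Formula n → (V : Open) → Vector (Sec.Carrier V) n →
               Set (lsuc ℓ)
  OpenForces φ V a = ∀ x → x ∈ points V → Forces φ V a x

-- The whole space is the intersection of no open sets.
record IsFilter {ℓ} (X : TopologicalSpace ℓ)
                (𝔽 : Pred (TopologicalSpace.Open X) (lsuc ℓ)) :
                Set (lsuc ℓ) where
  open TopologicalSpace X
  field
    whole∈   : whole ∈ 𝔽
    ⊓-closed : ∀ {U V} → U ∈ 𝔽 → V ∈ 𝔽 → U ⊓ V ∈ 𝔽
    ⊑-closed : ∀ {U V} → U ⊑ V → U ∈ 𝔽 → V ∈ 𝔽

module _ {ℓ} {G : Group ℓ ℓ} {L : Language ℓ} {X : TopologicalSpace ℓ}
         (M : Presheaf G L X) (𝔽 : Pred (TopologicalSpace.Open X) (lsuc ℓ)) where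
  open TopologicalSpace X
  open Presheaf M
  open Syntax L

  record IsGeneric : Set (lsuc ℓ) where
    field
      isFilter   : IsFilter X 𝔽
      nontrivial : ∀ U → Empty (points U) → ¬ U ∈ 𝔽
      decides    : ∀ {n} (φ : Formula n) U → U ∈ 𝔽 →
                   (a : Vector (Sec.Carrier U) n) →
                   ∃ λ V → V ∈ 𝔽 × Σ (V ⊑ U) λ p →
                     OpenForces M φ V (a ↾ p) ⊎ OpenForces M (¬′ φ) V (a ↾ p)
      witnesses  : ∀ {n} m (φ : Formula (m + n)) U → U ∈ 𝔽 →
                   (a : Vector (Sec.Carrier U) n) →
                   OpenForces M (∃^ m φ) U a →
                   ∃ λ V → V ∈ 𝔽 × Σ (V ⊑ U) λ p →
                     ∃ λ (b : Vector (Sec.Carrier V) m) →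
                       OpenForces M φ V (b ++ (a ↾ p))

module GenericModel {ℓ} {G : Group ℓ ℓ} {L : Language ℓ} {X : TopologicalSpace ℓ}
         (M : Presheaf G L X) {𝔽 : Pred (TopologicalSpace.Open X) (lsuc ℓ)}
         (isFilter : IsFilter X 𝔽) where
  open TopologicalSpace X
  open Presheaf M
  open Language L
  open IsFilter isFilter

  record Germ : Set (lsuc ℓ) where
    constructor mkGerm
    field
      dom   : Open
      dom∈𝔽 : dom ∈ 𝔽
      sec   : Sec.Carrier dom

  open Germ public

  infix 4 _∼_

  _∼_ : Germ → Germ → Set (lsuc ℓ)
  x ∼ y = ∃ λ W → W ∈ 𝔽 × Σ (W ⊑ dom x) λ p → Σ (W ⊑ dom y) λ q →
          Sec._≈_ W (res p (sec x)) (res q (sec y))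

  germs : ∀ {n U} → U ∈ 𝔽 → Vector (Sec.Carrier U) n → Vector Germ n
  germs {U = U} U∈𝔽 a i = mkGerm U U∈𝔽 (a i)

  ⨅ : ∀ {k} → Vector Open k → Open
  ⨅ {zero}  U = whole
  ⨅ {suc k} U = U zero ⊓ ⨅ (U ∘ suc)

  ⨅∈𝔽 : ∀ {k} (U : Vector Open k) → (∀ i → U i ∈ 𝔽) → ⨅ U ∈ 𝔽
  ⨅∈𝔽 {zero}  U U∈𝔽 = whole∈
  ⨅∈𝔽 {suc k} U U∈𝔽 = ⊓-closed (U∈𝔽 zero) (⨅∈𝔽 (U ∘ suc) (U∈𝔽 ∘ suc))

  ⨅⊑ : ∀ {k} (U : Vector Open k) i → ⨅ U ⊑ U i
  ⨅⊑ {suc k} U zero    = ⊓⊑ˡ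
  ⨅⊑ {suc k} U (suc i) = ⊑-trans ⊓⊑ʳ (⨅⊑ (U ∘ suc) i)

  commonSections : ∀ {k} (xs : Vector Germ k) →
                   Vector (Sec.Carrier (⨅ (dom ∘ xs))) k
  commonSections xs i = res (⨅⊑ (dom ∘ xs) i) (sec (xs i))

  funᵍ : (f : Fun) → Vector Germ (funArity f) → Germ
  funᵍ f xs = mkGerm (⨅ (dom ∘ xs)) (⨅∈𝔽 (dom ∘ xs) (dom∈𝔽 ∘ xs))
                     (Sec.funᴵ _ f (commonSections xs))

  relᵍ : (R : Rel) → Pred (Vector Germ (relArity R)) (lsuc ℓ)
  relᵍ R xs = ∃ λ W → Σ (W ∈ 𝔽) λ W∈𝔽 →
              ∃ λ (ys : Vector (Sec.Carrier W) (relArity R)) →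
              (∀ i → germs W∈𝔽 ys i ∼ xs i) × Sec.relᴵ W R ys

  conᵍ : Con → Germ
  conᵍ c = mkGerm whole whole∈ (Sec.conᴵ whole c)

  infixr 7 _•ᵍ_

  _•ᵍ_ : Group.Carrier G → Germ → Germ
  g •ᵍ x = mkGerm (dom x) (dom∈𝔽 x) (Sec._•_ (dom x) g (sec x))

  res-cong : ∀ {U V} (p : U ⊑ V) {s t} → Sec._≈_ V s t →
             Sec._≈_ U (res p s) (res p t)
  res-cong p = GMorphism.cong (ρ p)

  ρ-irr : ∀ {U V W} (p : U ⊑ V) (q : V ⊑ W) (p′ : U ⊑ W) s →
          Sec._≈_ U (res p′ s) (res p (res q s))
  ρ-irr {U} p q p′ s = Sec.sym U (ρ-comp p q p′ s)

  ≈⇒∼ : ∀ {U} (U∈ U∈′ : U ∈ 𝔽) {s t} → Sec._≈_ U s t →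
        mkGerm U U∈ s ∼ mkGerm U U∈′ t
  ≈⇒∼ {U} U∈ _ s≈t = U , U∈ , ⊑-refl , ⊑-refl , res-cong ⊑-refl s≈t

  ∼-refl : ∀ {x} → x ∼ x
  ∼-refl {x} = ≈⇒∼ (dom∈𝔽 x) (dom∈𝔽 x) (Sec.refl (dom x))

  ∼-sym : ∀ {x y} → x ∼ y → y ∼ x
  ∼-sym (W , W∈ , p , q , e) = W , W∈ , q , p , Sec.sym W e

  shrink : ∀ {W W′ U V} (r : W′ ⊑ W) {p : W ⊑ U} {q : W ⊑ V}
           {s : Sec.Carrier U} {t : Sec.Carrier V} →
           Sec._≈_ W (res p s) (res q t) →
           (p′ : W′ ⊑ U) (q′ : W′ ⊑ V) → Sec._≈_ W′ (res p′ s) (res q′ t)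
  shrink {W′ = W′} r {p} {q} {s} {t} e p′ q′ = begin
    res p′ s         ≈⟨ ρ-irr r p p′ s ⟩
    res r (res p s)  ≈⟨ res-cong r e ⟩
    res r (res q t)  ≈⟨ ρ-comp r q q′ t ⟩
    res q′ t         ∎
    where open ≈-Reasoning (Sec.setoid W′)

  ∼-trans : ∀ {x y z} → x ∼ y → y ∼ z → x ∼ z
  ∼-trans {x} {y} {z} (W , W∈ , p , q , e) (W′ , W∈′ , p′ , q′ , e′) =
    W ⊓ W′ , ⊓-closed W∈ W∈′ , a , c ,
    Sec.trans (W ⊓ W′) (shrink ⊓⊑ˡ e a b) (shrink ⊓⊑ʳ e′ b c)
    where
    a : W ⊓ W′ ⊑ dom x
    a = ⊑-trans ⊓⊑ˡ p
    b : W ⊓ W′ ⊑ dom y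
    b = ⊑-trans ⊓⊑ˡ q
    c : W ⊓ W′ ⊑ dom z
    c = ⊑-trans ⊓⊑ʳ q′

  funᵍ-rep : ∀ f {xs W} (W∈ : W ∈ 𝔽) (p : ∀ i → W ⊑ dom (xs i)) →
             funᵍ f xs ∼ mkGerm W W∈ (Sec.funᴵ W f (λ i → res (p i) (sec (xs i))))
  funᵍ-rep f {xs} {W} W∈ p =
    D ⊓ W , ⊓-closed (dom∈𝔽 (funᵍ f xs)) W∈ , l , r , (begin
      res l (Sec.funᴵ D f (commonSections xs))
        ≈⟨ GMorphism.fun-homo (ρ l) f _ ⟩
      Sec.funᴵ (D ⊓ W) f (λ i → res l (res (d i) (sec (xs i))))
        ≈⟨ Sec.funᴵ-cong (D ⊓ W) f (λ i → Sec.trans (D ⊓ W)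
             (ρ-comp l (d i) (⊑-trans r (p i)) (sec (xs i)))
             (ρ-irr r (p i) (⊑-trans r (p i)) (sec (xs i)))) ⟩
      Sec.funᴵ (D ⊓ W) f (λ i → res r (res (p i) (sec (xs i))))
        ≈⟨ GMorphism.fun-homo (ρ r) f _ ⟨
      res r (Sec.funᴵ W f (λ i → res (p i) (sec (xs i)))) ∎)
    where
    D : Open
    D = ⨅ (dom ∘ xs)
    d : ∀ i → D ⊑ dom (xs i)
    d = ⨅⊑ (dom ∘ xs)
    l : D ⊓ W ⊑ D
    l = ⊓⊑ˡ
    r : D ⊓ W ⊑ W
    r = ⊓⊑ʳ
    open ≈-Reasoning (Sec.setoid (D ⊓ W))

  funᵍ-cong : ∀ f {xs ys} → (∀ i → xs i ∼ ys i) → funᵍ f xs ∼ funᵍ f ys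
  funᵍ-cong f {xs} {ys} e =
    ∼-trans {funᵍ f xs} {atW {xs} p} {funᵍ f ys} (funᵍ-rep f {xs} W∈ p)
      (∼-trans {atW {xs} p} {atW {ys} q} {funᵍ f ys}
        (≈⇒∼ W∈ W∈ (Sec.funᴵ-cong W f λ i →
          shrink (⨅⊑ (proj₁ ∘ e) i) (proj₂ (proj₂ (proj₂ (proj₂ (e i)))))
                 (p i) (q i)))
        (∼-sym {funᵍ f ys} {atW {ys} q} (funᵍ-rep f {ys} W∈ q)))
    where
    W : Open
    W = ⨅ (proj₁ ∘ e)
    W∈ : W ∈ 𝔽
    W∈ = ⨅∈𝔽 (proj₁ ∘ e) (λ i → proj₁ (proj₂ (e i)))
    p : ∀ i → W ⊑ dom (xs i)
    p i = ⊑-trans (⨅⊑ (proj₁ ∘ e) i) (proj₁ (proj₂ (proj₂ (e i))))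
    q : ∀ i → W ⊑ dom (ys i)
    q i = ⊑-trans (⨅⊑ (proj₁ ∘ e) i) (proj₁ (proj₂ (proj₂ (proj₂ (e i)))))
    atW : ∀ {zs : Vector Germ (funArity f)} → (∀ i → W ⊑ dom (zs i)) → Germ
    atW {zs} r = mkGerm W W∈ (Sec.funᴵ W f (λ i → res (r i) (sec (zs i))))

  •ᵍ-cong : ∀ {g h x y} → Group._≈_ G g h → x ∼ y → g •ᵍ x ∼ h •ᵍ y
  •ᵍ-cong {g} {h} {x} {y} g≈h (W , W∈ , p , q , e) = W , W∈ , p , q , (begin
    res p (Sec._•_ (dom x) g (sec x))  ≈⟨ GMorphism.equivariant (ρ p) g (sec x) ⟩
    Sec._•_ W g (res p (sec x))        ≈⟨ Sec.•-cong W g≈h e ⟩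
    Sec._•_ W h (res q (sec y))        ≈⟨ GMorphism.equivariant (ρ q) h (sec y) ⟨
    res q (Sec._•_ (dom y) h (sec y))  ∎)
    where open ≈-Reasoning (Sec.setoid W)

  genericStructure : Structure L (lsuc ℓ)
  genericStructure = record
    { setoid    = record
      { Carrier       = Germ
      ; _≈_           = _∼_
      ; isEquivalence = record
        { refl  = λ {x} → ∼-refl {x}
        ; sym   = λ {x} {y} → ∼-sym {x} {y}
        ; trans = λ {x} {y} {z} → ∼-trans {x} {y} {z}
        }
      }
    ; funᴵ      = funᵍ
    ; funᴵ-cong = λ f {xs} {ys} → funᵍ-cong f {xs} {ys}
    ; relᴵ      = relᵍ
    ; relᴵ-resp = λ R {xs} {ys} e (W , W∈ , zs , zs∼xs , r) →
        W , W∈ , zs ,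
        (λ i → ∼-trans {germs W∈ zs i} {xs i} {ys i} (zs∼xs i) (e i)) , r
    ; conᴵ      = conᵍ
    }

  genericModel : GStructure G L (lsuc ℓ)
  genericModel = record
    { structure       = genericStructure
    ; _•_             = _•ᵍ_
    ; •-cong          = λ {g} {h} {x} {y} → •ᵍ-cong {g} {h} {x} {y}
    ; ε-•             = λ x → ≈⇒∼ (dom∈𝔽 x) (dom∈𝔽 x) (Sec.ε-• (dom x) (sec x))
    ; ∙-•             = λ g h x →
        ≈⇒∼ (dom∈𝔽 x) (dom∈𝔽 x) (Sec.∙-• (dom x) g h (sec x))
    ; con-invariant   = λ g c → proj₁ (Sec.con-invariant whole g c) ,
        ≈⇒∼ whole∈ whole∈ (proj₂ (Sec.con-invariant whole g c))
    ; rel-invariant   = λ R g xs (W , W∈ , ys , ys∼xs , r) →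
        W , W∈ , (λ i → Sec._•_ W (g i) (ys i)) ,
        (λ i → •ᵍ-cong {g i} {g i} {germs W∈ ys i} {xs i}
                 (Group.refl G) (ys∼xs i)) ,
        Sec.rel-invariant W R g ys r
    ; fun-equivariant = λ f g xs →
        let D   = ⨅ (dom ∘ xs)
            D∈  = ⨅∈𝔽 (dom ∘ xs) (dom∈𝔽 ∘ xs)
            d   = ⨅⊑ (dom ∘ xs)
        in ≈⇒∼ D∈ D∈ (Sec.trans D
             (Sec.funᴵ-cong D f λ i → GMorphism.equivariant (ρ (d i)) g (sec (xs i)))
             (Sec.fun-equivariant D f g (commonSections xs)))
    }

{-# OPTIONS --safe #-}

-- Forcing of φ(a) at x depends only on the germ of a at x, holds on an open
-- set of points, and satisfies ¬¬φ_𝔾 → φ_𝔾.  Call φ(a) generically forced if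
-- some member of the filter forces it.  A generic filter decides every formula
-- and never forces both φ and ¬φ, so being generically forced commutes with the
-- propositional connectives; atomic formulas are handled by gluing.  For the
-- quantifiers, decide ∃w ¬φ_𝔾: either genericity provides a counterexample, or
-- ¬∃w ¬φ_𝔾 is forced, which gives ∀w ¬¬φ_𝔾 and hence ∀w φ_𝔾.

module Submission where

open import Algebra.Bundles using (Group)
open import Data.Bool.Base using (true; false; _∧_)
open import Data.Bool.Properties using (∧-conicalˡ; ∧-conicalʳ)
open import Data.Empty using (⊥-elim)
open import Data.Fin.Base using (zero) renaming (suc to fsuc)
open import Data.Nat.Base using (ℕ)
open import Data.Product.Base using (∃; Σ; _×_; _,_; proj₁; proj₂)
open import Data.Sum.Base using (_⊎_; inj₁; inj₂)
open import Data.Vec.Functional using (Vector; _∷_; _++_)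
open import Function.Base using (_∘_)
open import Function.Bundles using (Equivalence; _⇔_; mk⇔)
open import Level using (Level; suc)
open import Relation.Binary.PropositionalEquality.Core using (_≡_; refl)
open import Relation.Nullary.Negation.Core using (¬_)
open import Relation.Unary using (Pred; _∈_; _≐′_; _⊆′_; ⋃)
open import Defs

-- Satisfaction respects the equality of a structure.

module _ {ℓ s} {L : Language ℓ} (A : Structure L s) where
  open Structure A using (Carrier; _≈_; funᴵ-cong; relᴵ-resp)
    renaming (refl to ≈-refl; sym to ≈-sym; trans to ≈-trans)
  open Syntax L
  open Semantics A

  eval-cong : ∀ {n} (t : Term n) {a b : Vector Carrier n} →
              (∀ i → a i ≈ b i) → eval t a ≈ eval t b
  eval-cong (var i)    e = e i
  eval-cong (con c)    e = ≈-refl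
  eval-cong (fun f ts) e = funᴵ-cong f λ i → eval-cong (ts i) e

  ∷-cong : ∀ {n} {c : Carrier} {a b : Vector Carrier n} →
           (∀ i → a i ≈ b i) → ∀ i → (c ∷ a) i ≈ (c ∷ b) i
  ∷-cong e zero     = ≈-refl
  ∷-cong e (fsuc i) = e i

  ⊨-cong : ∀ {n} (φ : Formula n) {a b : Vector Carrier n} →
           (∀ i → a i ≈ b i) → ⊨ φ [ a ] → ⊨ φ [ b ]
  ⊨-cong (t ≈′ u)   e h = ≈-trans (≈-sym (eval-cong t e)) (≈-trans h (eval-cong u e))
  ⊨-cong (rel R ts) e h = relᴵ-resp R (λ i → eval-cong (ts i) e) h
  ⊨-cong (¬′ φ)     e h = h ∘ ⊨-cong φ (≈-sym ∘ e)
  ⊨-cong (φ ∧′ ψ)   e (h , k) = ⊨-cong φ e h , ⊨-cong ψ e k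
  ⊨-cong (φ ∨′ ψ)   e (inj₁ h) = inj₁ (⊨-cong φ e h)
  ⊨-cong (φ ∨′ ψ)   e (inj₂ h) = inj₂ (⊨-cong ψ e h)
  ⊨-cong (φ ⇒′ ψ)   e h = ⊨-cong ψ e ∘ h ∘ ⊨-cong φ (≈-sym ∘ e)
  ⊨-cong (∀′ φ)     e h c = ⊨-cong φ (∷-cong e) (h c)
  ⊨-cong (∃′ φ)     e (c , h) = c , ⊨-cong φ (∷-cong e) h

-- Positive formulas and morphisms.

module _ {ℓ s} {G : Group ℓ ℓ} {L : Language ℓ} {A B : GStructure G L s}
         (h : GMorphism A B) where
  private
    module A = GStructure A
    module B = GStructure B
  open GMorphism h using (to; cong; fun-homo; con-homo; rel-homo)
  open Syntax L

  eval-homo : ∀ {n} (t : Term n) {a : Vector A.Carrier n} {b : Vector B.Carrier n} →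
              (∀ i → to (a i) B.≈ b i) →
              to (Semantics.eval A.structure t a) B.≈ Semantics.eval B.structure t b
  eval-homo (var i)    e = e i
  eval-homo (con c)    e = con-homo c
  eval-homo (fun f ts) e =
    B.trans (fun-homo f _) (B.funᴵ-cong f λ i → eval-homo (ts i) e)

  -- Morphisms preserve relations in one direction only and need not be surjective, so the induction
  -- goes through exactly for the connectives that `positive` admits.
  ⊨-homo : ∀ {n} (φ : Formula n) → positive φ ≡ true →
           {a : Vector A.Carrier n} {b : Vector B.Carrier n} →
           (∀ i → to (a i) B.≈ b i) →
           A.structure ⊨ φ [ a ] → B.structure ⊨ φ [ b ]
  ⊨-homo (t ≈′ u)   _ e q =
    B.trans (B.sym (eval-homo t e)) (B.trans (cong q) (eval-homo u e))
  ⊨-homo (rel R ts) _ e q =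
    B.relᴵ-resp R (λ i → eval-homo (ts i) e) (rel-homo R _ q)
  ⊨-homo (φ ∧′ ψ)   + e (q , r) =
    ⊨-homo φ (∧-conicalˡ _ _ +) e q , ⊨-homo ψ (∧-conicalʳ _ _ +) e r
  ⊨-homo (φ ∨′ ψ)   + e (inj₁ q) = inj₁ (⊨-homo φ (∧-conicalˡ _ _ +) e q)
  ⊨-homo (φ ∨′ ψ)   + e (inj₂ r) = inj₂ (⊨-homo ψ (∧-conicalʳ _ _ +) e r)
  ⊨-homo (∃′ φ)     + {a} {b} e (c , q) = to c , ⊨-homo φ + e′ q
    where
    e′ : ∀ i → to ((c ∷ a) i) B.≈ (to c ∷ b) i
    e′ zero     = B.refl
    e′ (fsuc i) = e i

module _ {ℓ} {L : Language ℓ} where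
  open Syntax L

  -- Selects the componentwise branch of the forcing clauses for `∧′` and `∃′`, which test
  -- `positive`.
  gödel-nonpositive : ∀ {n} (φ : Formula n) → positive (gödel φ) ≡ false
  gödel-nonpositive (s ≈′ t)   = refl
  gödel-nonpositive (rel R ts) = refl
  gödel-nonpositive (¬′ φ)     = refl
  gödel-nonpositive (φ ∧′ ψ) rewrite gödel-nonpositive φ = refl
  gödel-nonpositive (φ ∨′ ψ)   = refl
  gödel-nonpositive (φ ⇒′ ψ)   = refl
  gödel-nonpositive (∀′ φ)     = refl
  gödel-nonpositive (∃′ φ)     = refl

-- Tuples of sections with the same germs.

module Restriction {ℓ} {G : Group ℓ ℓ} {L : Language ℓ} {X : TopologicalSpace ℓ}
                   (M : Presheaf G L X) where
  open TopologicalSpace X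
  open Presheaf M

  res-irr : ∀ {U V} (p q : U ⊑ V) s → Sec._≈_ U (res p s) (res q s)
  res-irr {U} p q s =
    Sec.trans U (Sec.sym U (ρ-id ⊑-refl (res p s))) (ρ-comp ⊑-refl p q s)

  -- Tuples over different open sets that agree on `N` have the same germ at each point of `N`.
  Agree : ∀ {n N U V} → N ⊑ U → N ⊑ V →
          Vector (Sec.Carrier U) n → Vector (Sec.Carrier V) n → Set ℓ
  Agree {N = N} p q a b = ∀ i → Sec._≈_ N (res p (a i)) (res q (b i))

  module _ {n : ℕ} {N U V : Open} {p : N ⊑ U} {q : N ⊑ V}
           {a : Vector (Sec.Carrier U) n} {b : Vector (Sec.Carrier V) n} where

    agree-sym : Agree p q a b → Agree q p b a
    agree-sym e i = Sec.sym N (e i)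

    agree-shrink : ∀ {N′} → N′ ⊑ N → (p′ : N′ ⊑ U) (q′ : N′ ⊑ V) →
                   Agree p q a b → Agree p′ q′ a b
    agree-shrink {N′} r p′ q′ e i =
      Sec.trans N′ (Sec.sym N′ (ρ-comp r p p′ (a i)))
        (Sec.trans N′ (GMorphism.cong (ρ r) (e i)) (ρ-comp r q q′ (b i)))

  agree-↾ : ∀ {n N U V} (p : N ⊑ U) (q : N ⊑ V) (r : U ⊑ V)
            (a : Vector (Sec.Carrier V) n) → Agree p q (a ↾ r) a
  agree-↾ p q r a i = ρ-comp p r q (a i)

-- Locality and openness of forcing.

module Forcing {ℓ} {G : Group ℓ ℓ} {L : Language ℓ} {X : TopologicalSpace ℓ}
               (M : Presheaf G L X) where
  open TopologicalSpace X
  open Presheaf M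
  open Syntax L
  open Restriction M

  holdsNear-germ : ∀ {n} (φ : Formula n) → positive φ ≡ true → ∀ {N U V}
                   (p : N ⊑ U) (q : N ⊑ V)
                   (a : Vector (Sec.Carrier U) n) (b : Vector (Sec.Carrier V) n) →
                   Agree p q a b → ∀ {x} → x ∈ points N →
                   HoldsNear M φ U a x → HoldsNear M φ V b x
  holdsNear-germ φ + {N} p q a b e x∈N (W , x∈W , r , h) =
    W ⊓ N , (x∈W , x∈N) , ⊑-trans ⊓⊑ʳ q ,
    ⊨-homo (ρ ⊓⊑ˡ) φ +
      (λ i → Sec.trans (W ⊓ N) (ρ-comp ⊓⊑ˡ r (⊑-trans ⊓⊑ʳ p) (a i))
               (agree-shrink ⊓⊑ʳ (⊑-trans ⊓⊑ʳ p) (⊑-trans ⊓⊑ʳ q) e i))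
      h

  -- Every neighbourhood in a forcing clause can be cut down to `N`, where the two tuples cannot be
  -- told apart. The hypothesis is symmetric in the tuples, because negation and implication use the
  -- induction hypothesis in the reverse direction.
  forces-germ : ∀ {n} (φ : Formula n) {N U V} (p : N ⊑ U) (q : N ⊑ V)
                (a : Vector (Sec.Carrier U) n) (b : Vector (Sec.Carrier V) n) →
                Agree p q a b → ∀ {x} → x ∈ points N →
                Forces M φ U a x → Forces M φ V b x
  forces-germ (s ≈′ t)   = holdsNear-germ (s ≈′ t) refl
  forces-germ (rel R ts) = holdsNear-germ (rel R ts) refl
  forces-germ (¬′ φ) {N} p q a b e x∈N (W , x∈W , _ , h) =
    W ⊓ N , (x∈W , x∈N) , ⊑-trans ⊓⊑ʳ q ,
    λ y (y∈W , y∈N) → h y y∈W ∘ forces-germ φ q p b a (agree-sym e) y∈N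
  forces-germ (φ ∧′ ψ) p q a b e x∈N h with positive φ ∧ positive ψ in +
  ... | true  = holdsNear-germ (φ ∧′ ψ) + p q a b e x∈N h
  ... | false = forces-germ φ p q a b e x∈N (proj₁ h) , forces-germ ψ p q a b e x∈N (proj₂ h)
  forces-germ (φ ∨′ ψ) p q a b e x∈N h with positive φ ∧ positive ψ in + | h
  ... | true  | h      = holdsNear-germ (φ ∨′ ψ) + p q a b e x∈N h
  ... | false | inj₁ h = inj₁ (forces-germ φ p q a b e x∈N h)
  ... | false | inj₂ h = inj₂ (forces-germ ψ p q a b e x∈N h)
  forces-germ (φ ⇒′ ψ) {N} p q a b e x∈N (W , x∈W , _ , h) =
    W ⊓ N , (x∈W , x∈N) , ⊑-trans ⊓⊑ʳ q ,
    λ y (y∈W , y∈N) → forces-germ ψ p q a b e y∈N ∘ h y y∈W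
                      ∘ forces-germ φ q p b a (agree-sym e) y∈N
  -- Any `W′` inside `W ⊓ N` is also inside `W`, so `h` accepts the section `c` as it is: the clause
  -- for `∀′` ranges over sections over all smaller open sets.
  forces-germ (∀′ φ) {N} p q a b e x∈N (W , x∈W , r , h) =
    W ⊓ N , (x∈W , x∈N) , ⊑-trans ⊓⊑ʳ q , λ W′ r′ y y∈W′ c →
      let p′ = ⊑-trans (⊑-trans r′ ⊓⊑ˡ) r
          q′ = ⊑-trans r′ (⊑-trans ⊓⊑ʳ q)
          e′ : Agree ⊑-refl ⊑-refl (c ∷ a ↾ p′) (c ∷ b ↾ q′)
          e′ = λ { zero     → Sec.refl W′
                 ; (fsuc i) → GMorphism.cong (ρ ⊑-refl)
                     (agree-shrink (⊑-trans r′ ⊓⊑ʳ) p′ q′ e i) }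
      in forces-germ φ ⊑-refl ⊑-refl (c ∷ a ↾ p′) (c ∷ b ↾ q′) e′ y∈W′
           (h W′ (⊑-trans r′ ⊓⊑ˡ) y y∈W′ c)
  forces-germ (∃′ φ) {N} p q a b e x∈N h with positive φ in +
  ... | true  = holdsNear-germ (∃′ φ) + p q a b e x∈N h
  ... | false =
    let (W , x∈W , r , c , h′) = h
        -- The witness `c` lives over `W`, which need not lie in the target open set, so it is
        -- restricted to `D`.
        D  = W ⊓ N
        q′ = ⊑-trans ⊓⊑ʳ q
        e′ : Agree {N = D} ⊓⊑ˡ ⊑-refl (c ∷ a ↾ r) (res ⊓⊑ˡ c ∷ b ↾ q′)
        e′ = λ { zero     → Sec.sym D (ρ-id ⊑-refl _)
               ; (fsuc i) → Sec.trans D (ρ-comp ⊓⊑ˡ r (⊑-trans ⊓⊑ʳ p) (a i))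
                   (Sec.trans D (agree-shrink ⊓⊑ʳ (⊑-trans ⊓⊑ʳ p) q′ e i)
                     (Sec.sym D (ρ-id ⊑-refl _))) }
    in D , (x∈W , x∈N) , q′ , res ⊓⊑ˡ c ,
       forces-germ φ ⊓⊑ˡ ⊑-refl _ _ e′ (x∈W , x∈N) h′

  forces-restrict : ∀ {n} (φ : Formula n) {U V} (p : V ⊑ U) (a : Vector (Sec.Carrier U) n)
                    {x} → x ∈ points V → Forces M φ U a x → Forces M φ V (a ↾ p) x
  forces-restrict φ p a =
    forces-germ φ p ⊑-refl a (a ↾ p) (agree-sym (agree-↾ ⊑-refl p p a))

  forces-extend : ∀ {n} (φ : Formula n) {U V} (p : V ⊑ U) (a : Vector (Sec.Carrier U) n)
                  {x} → x ∈ points V → Forces M φ V (a ↾ p) x → Forces M φ U a x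
  forces-extend φ p a = forces-germ φ ⊑-refl p (a ↾ p) a (agree-↾ ⊑-refl p p a)

  -- A neighbourhood given by a clause for `¬′`, `⇒′`, `∀′` or by `HoldsNear` serves all its points
  -- at once; only the componentwise clauses need induction.
  forces-open : ∀ {n} (φ : Formula n) U (a : Vector (Sec.Carrier U) n) {x} →
                Forces M φ U a x →
                ∃ λ N → x ∈ points N × N ⊑ U × (points N ⊆′ Forces M φ U a)
  forces-open (s ≈′ t)   U a (V , x∈V , p , h) = V , x∈V , p , λ y y∈V → V , y∈V , p , h
  forces-open (rel R ts) U a (V , x∈V , p , h) = V , x∈V , p , λ y y∈V → V , y∈V , p , h
  forces-open (¬′ φ)     U a (V , x∈V , p , h) = V , x∈V , p , λ y y∈V → V , y∈V , p , h
  forces-open (φ ∧′ ψ)   U a h with positive φ ∧ positive ψ | h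
  ... | true  | V , x∈V , p , h = V , x∈V , p , λ y y∈V → V , y∈V , p , h
  ... | false | h , k =
    let (V , x∈V , p , f) = forces-open φ U a h
        (W , x∈W , q , g) = forces-open ψ U a k
    in V ⊓ W , (x∈V , x∈W) , ⊑-trans ⊓⊑ˡ p , λ y (y∈V , y∈W) → f y y∈V , g y y∈W
  forces-open (φ ∨′ ψ)   U a h with positive φ ∧ positive ψ | h
  ... | true  | V , x∈V , p , h = V , x∈V , p , λ y y∈V → V , y∈V , p , h
  ... | false | inj₁ h =
    let (V , x∈V , p , f) = forces-open φ U a h in V , x∈V , p , λ y → inj₁ ∘ f y
  ... | false | inj₂ h =
    let (V , x∈V , p , f) = forces-open ψ U a h in V , x∈V , p , λ y → inj₂ ∘ f y
  forces-open (φ ⇒′ ψ)   U a (V , x∈V , p , h) = V , x∈V , p , λ y y∈V → V , y∈V , p , h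
  forces-open (∀′ φ)     U a (V , x∈V , p , h) = V , x∈V , p , λ y y∈V → V , y∈V , p , h
  forces-open (∃′ φ)     U a h with positive φ | h
  ... | true  | V , x∈V , p , h = V , x∈V , p , λ y y∈V → V , y∈V , p , h
  ... | false | V , x∈V , p , b , h =
    let (N , x∈N , q , f) = forces-open φ V (b ∷ a ↾ p) h
    in N , x∈N , ⊑-trans q p , λ y y∈N → V , ⊑⇒⊆ q y y∈N , p , b , f y y∈N

  -- The union of the neighbourhoods from `forces-open`, indexed by the forced points together with
  -- their proofs of forcing.
  forcedSet : ∀ {n} (φ : Formula n) U (a : Vector (Sec.Carrier U) n) →
              ∃ λ W → points W ≐′ Forces M φ U a
  forcedSet φ U a =
    let (Q , Q-open , Q⊆ , ⊆Q) =
          ⋃-open {I = ∃ (Forces M φ U a)} (λ (_ , h) → points (proj₁ (forces-open φ U a h)))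
                 (λ (_ , h) → isOpen (proj₁ (forces-open φ U a h)))
    in mkOpen Q Q-open ,
       (λ x x∈Q → let ((_ , h) , x∈N) = Q⊆ x x∈Q
                  in proj₂ (proj₂ (proj₂ (forces-open φ U a h))) x x∈N) ,
       (λ x h → ⊆Q x ((x , h) , proj₁ (proj₂ (forces-open φ U a h))))

  forces⇒∈ : ∀ {n} (φ : Formula n) U (a : Vector (Sec.Carrier U) n) {x} →
             Forces M φ U a x → x ∈ points U
  forces⇒∈ φ U a {x} h = let (_ , x∈N , p , _) = forces-open φ U a h in ⊑⇒⊆ p x x∈N

  -- Forcing of connectives and quantifiers.

  module _ {n : ℕ} (φ ψ : Formula n) (- : positive φ ≡ false)
           {U : Open} {a : Vector (Sec.Carrier U) n} {x : Point} where

    forces-∧⁻ : Forces M (φ ∧′ ψ) U a x → Forces M φ U a x × Forces M ψ U a x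
    forces-∧⁻ h rewrite - = h

    forces-∧⁺ : Forces M φ U a x → Forces M ψ U a x → Forces M (φ ∧′ ψ) U a x
    forces-∧⁺ h k rewrite - = h , k

  -- A section over `W` for which `φ` is forced at `z` would itself witness the existential formula
  -- at `z`.
  ¬∃⇒∀¬ : ∀ {n} (φ : Formula (ℕ.suc n)) → positive φ ≡ false →
          ∀ U (a : Vector (Sec.Carrier U) n) {x} →
          Forces M (¬′ ∃′ φ) U a x → Forces M (∀′ ¬′ φ) U a x
  ¬∃⇒∀¬ φ - U a (V , x∈V , p , h) rewrite - = V , x∈V , p , λ W q y y∈W b →
    W , y∈W , ⊑-refl , λ z z∈W k →
      h z (⊑⇒⊆ q z z∈W) (W , z∈W , ⊑-trans q p , b , k)

  ∀-mono : ∀ {n} (φ ψ : Formula (ℕ.suc n)) U (a : Vector (Sec.Carrier U) n) →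
           (∀ W (b : Vector (Sec.Carrier W) (ℕ.suc n)) {y} →
             Forces M φ W b y → Forces M ψ W b y) →
           ∀ {x} → Forces M (∀′ φ) U a x → Forces M (∀′ ψ) U a x
  ∀-mono φ ψ U a f (V , x∈V , p , h) =
    V , x∈V , p , λ W q y y∈W b → f W (b ∷ a ↾ ⊑-trans q p) (h W q y y∈W b)

  -- `W` need not lie in the neighbourhood `V` of the forcing clause: `b` is restricted to `V ⊓ W`,
  -- and locality carries the result back to `W`.
  forces-∀⁻ : ∀ {n} (φ : Formula (ℕ.suc n)) {U} (a : Vector (Sec.Carrier U) n) {x} →
              Forces M (∀′ φ) U a x → ∀ {W} (p : W ⊑ U) → x ∈ points W →
              (b : Sec.Carrier W) → Forces M φ W (b ∷ a ↾ p) x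
  forces-∀⁻ φ a {x} (V , x∈V , q , h) {W} p x∈W b =
    forces-germ φ {N = D} ⊑-refl ⊓⊑ʳ (res ⊓⊑ʳ b ∷ a ↾ q′) (b ∷ a ↾ p) e (x∈V , x∈W)
      (h D ⊓⊑ˡ x (x∈V , x∈W) (res ⊓⊑ʳ b))
    where
    D = V ⊓ W
    q′ = ⊑-trans ⊓⊑ˡ q
    e : Agree {N = D} ⊑-refl ⊓⊑ʳ (res ⊓⊑ʳ b ∷ a ↾ q′) (b ∷ a ↾ p)
    e zero     = ρ-id ⊑-refl _
    e (fsuc i) = Sec.trans D (ρ-id ⊑-refl _) (Sec.sym D (ρ-comp ⊓⊑ʳ p q′ (a i)))

  -- Double negation and stability of the Gödel translation.

  module _ {n : ℕ} (φ : Formula n) {U : Open} {a : Vector (Sec.Carrier U) n} where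

    forces-¬⁻ : ∀ {x} → Forces M (¬′ φ) U a x → ¬ Forces M φ U a x
    forces-¬⁻ (V , x∈V , _ , h) = h _ x∈V

    -- By openness `φ` is forced on a neighbourhood, no point of which can force its negation.
    ¬¬-intro : ∀ {x} → Forces M φ U a x → Forces M (¬′ ¬′ φ) U a x
    ¬¬-intro h = let (N , x∈N , p , f) = forces-open φ U a h
                 in N , x∈N , p , λ y y∈N k → forces-¬⁻ k (f y y∈N)

  ¬-contra : ∀ {n} (φ ψ : Formula n) {U} {a : Vector (Sec.Carrier U) n} →
             (∀ {y} → Forces M φ U a y → Forces M ψ U a y) →
             ∀ {x} → Forces M (¬′ ψ) U a x → Forces M (¬′ φ) U a x
  ¬-contra φ ψ f (V , x∈V , p , h) = V , x∈V , p , λ y y∈V → h y y∈V ∘ f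

  ¬-stable : ∀ {n} (φ : Formula n) U (a : Vector (Sec.Carrier U) n) {x} →
             Forces M (¬′ ¬′ ¬′ φ) U a x → Forces M (¬′ φ) U a x
  ¬-stable φ U a = ¬-contra φ (¬′ ¬′ φ) (¬¬-intro φ)

  -- Translations of atoms, negations, disjunctions and existential formulas are negations, hence
  -- stable by `¬-stable`; `∧′`, `⇒′` and `∀′` inherit stability from their components.
  gödel-stable : ∀ {n} (φ : Formula n) U (a : Vector (Sec.Carrier U) n) {x} →
                 Forces M (¬′ ¬′ gödel φ) U a x → Forces M (gödel φ) U a x
  gödel-stable (s ≈′ t)   = ¬-stable (¬′ (s ≈′ t))
  gödel-stable (rel R ts) = ¬-stable (¬′ rel R ts)
  gödel-stable (¬′ φ)     = ¬-stable (gödel φ)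
  gödel-stable (φ ∧′ ψ) U a h =
    forces-∧⁺ φ′ ψ′ -
      (gödel-stable φ U a (¬-contra (¬′ φ′) (¬′ χ)
        (¬-contra χ φ′ (proj₁ ∘ forces-∧⁻ φ′ ψ′ -)) h))
      (gödel-stable ψ U a (¬-contra (¬′ ψ′) (¬′ χ)
        (¬-contra χ ψ′ (proj₂ ∘ forces-∧⁻ φ′ ψ′ -)) h))
    where
    φ′ = gödel φ
    ψ′ = gödel ψ
    χ  = φ′ ∧′ ψ′
    -  = gödel-nonpositive φ
  gödel-stable (φ ∨′ ψ)   = ¬-stable (¬′ gödel φ ∧′ ¬′ gödel ψ)
  -- Near a point forcing `gödel φ`, a neighbourhood where `gödel ψ` is nowhere forced would also
  -- refute the implication, against `h`. Hence the double negation of `gödel ψ` is forced, and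
  -- induction applies.
  gödel-stable (φ ⇒′ ψ) U a (V , x∈V , p , h) = V , x∈V , p , λ y y∈V k →
    let (N , y∈N , q , f) = forces-open (gödel φ) U a k
    in gödel-stable ψ U a
         ( V ⊓ N , (y∈V , y∈N) , ⊑-trans ⊓⊑ˡ p
         , λ z (z∈V , z∈N) (N′ , z∈N′ , q′ , g) → h z z∈V
             ( N ⊓ N′ , (z∈N , z∈N′) , ⊑-trans ⊓⊑ˡ q
             , λ u (u∈N , u∈N′) (_ , u∈O , _ , i) → g u u∈N′ (i u u∈O (f u u∈N))))
  -- For a fixed `b`, a neighbourhood refuting the instance at `b` would refute the universal
  -- formula, against `h`.
  gödel-stable (∀′ φ) U a (V , x∈V , p , h) = V , x∈V , p , λ W q y y∈W b →
    gödel-stable φ W (b ∷ a ↾ ⊑-trans q p)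
      ( W , y∈W , ⊑-refl
      , λ z z∈W (N , z∈N , r , g) → h z (⊑⇒⊆ q z z∈W)
          ( N , z∈N , ⊑-trans r (⊑-trans q p)
          , λ u u∈N k → g u u∈N
              (forces-∀⁻ (gödel φ) a k (⊑-trans q p) (⊑⇒⊆ r u u∈N) b)))
  gödel-stable (∃′ φ)     = ¬-stable (∀′ ¬′ gödel φ)

  -- Gluing of atomic formulas.

  module _ (sheaf : IsSheaf M) {n : ℕ} {U : Open} {a : Vector (Sec.Carrier U) n} where
    open IsSheaf sheaf

    private
      neighbourhood : ∀ φ → ∃ (HoldsNear M φ U a) → Open
      neighbourhood φ (_ , V , _) = V

      -- The neighbourhoods on which `φ` holds form the cover to which the sheaf conditions are
      -- applied.
      covers : ∀ φ → points U ⊆′ HoldsNear M φ U a →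
               points U ≐′ ⋃ _ (points ∘ neighbourhood φ)
      covers φ h =
        (λ x x∈U → (x , h x x∈U) , proj₁ (proj₂ (h x x∈U))) ,
        (λ x ((_ , _ , _ , p , _) , x∈V) → ⊑⇒⊆ p x x∈V)

      eval-res : ∀ {V} (p : V ⊑ U) (t : Term n) →
                 Sec._≈_ V (res p (Semantics.eval (Sec.structure U) t a))
                           (Semantics.eval (Sec.structure V) t (a ↾ p))
      eval-res {V} p t = eval-homo (ρ p) t λ i → Sec.refl V

    glue-≈ : ∀ t u → points U ⊆′ HoldsNear M (t ≈′ u) U a →
             Sec.structure U ⊨ t ≈′ u [ a ]
    glue-≈ t u h = coherence (covers (t ≈′ u) h) (λ (_ , _ , _ , p , _) → p) _ _
      λ (_ , V , _ , p , k) →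
        Sec.trans V (eval-res p t) (Sec.trans V k (Sec.sym V (eval-res p u)))

    glue-rel : ∀ R ts → points U ⊆′ HoldsNear M (rel R ts) U a →
               Sec.structure U ⊨ rel R ts [ a ]
    glue-rel R ts h =
      rel-exactness (covers (rel R ts) h) (λ (_ , _ , _ , p , _) → p) R _
      λ (_ , V , _ , p , k) → Sec.relᴵ-resp V R (λ i → Sec.sym V (eval-res p (ts i))) k

-- Classical behaviour of forcing along a generic filter.

module Genericity {ℓ} {G : Group ℓ ℓ} {L : Language ℓ} {X : TopologicalSpace ℓ}
                  (M : Presheaf G L X) (sheaf : IsSheaf M)
                  (𝔽 : Pred (TopologicalSpace.Open X) (suc ℓ))
                  (generic : IsGeneric M 𝔽) where
  open TopologicalSpace X
  open Presheaf M
  open Syntax L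
  open Restriction M
  open Forcing M
  open IsGeneric generic
  open IsFilter isFilter
  open GenericModel M isFilter
  open Semantics genericStructure using (eval)

  -- Unlike in clause (2) of the theorem, a is not restricted to V.
  GForces : ∀ {n} → Formula n → (U : Open) → Vector (Sec.Carrier U) n → Set (suc ℓ)
  GForces φ U a = ∃ λ V → V ∈ 𝔽 × V ⊑ U × (points V ⊆′ Forces M φ U a)

  module _ {n : ℕ} (φ : Formula n) {U : Open} {a : Vector (Sec.Carrier U) n} where

    -- Locality makes it immaterial whether `a` is restricted to `V` or kept over `U`.
    openForces⇒gForces : (∃ λ V → V ∈ 𝔽 × Σ (V ⊑ U) λ p → OpenForces M φ V (a ↾ p)) →
                         GForces φ U a
    openForces⇒gForces (V , V∈ , p , h) =
      V , V∈ , p , λ x x∈V → forces-extend φ p a x∈V (h x x∈V)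

    gForces⇒openForces : GForces φ U a →
                         ∃ λ V → V ∈ 𝔽 × Σ (V ⊑ U) λ p → OpenForces M φ V (a ↾ p)
    gForces⇒openForces (V , V∈ , p , h) =
      V , V∈ , p , λ x x∈V → forces-restrict φ p a x∈V (h x x∈V)

  gForces-decide : ∀ {n} (φ : Formula n) {U} → U ∈ 𝔽 → (a : Vector (Sec.Carrier U) n) →
                   GForces φ U a ⊎ GForces (¬′ φ) U a
  gForces-decide φ U∈ a with decides φ _ U∈ a
  ... | V , V∈ , p , inj₁ h = inj₁ (openForces⇒gForces φ (V , V∈ , p , h))
  ... | V , V∈ , p , inj₂ h = inj₂ (openForces⇒gForces (¬′ φ) (V , V∈ , p , h))

  module _ {n : ℕ} {φ ψ : Formula n} {U : Open} {a : Vector (Sec.Carrier U) n} where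

    gForces-map : (∀ {x} → Forces M φ U a x → Forces M ψ U a x) →
                  GForces φ U a → GForces ψ U a
    gForces-map f (V , V∈ , p , h) = V , V∈ , p , λ x x∈V → f (h x x∈V)

    gForces-zip : ∀ {χ} →
                  (∀ {x} → Forces M φ U a x → Forces M ψ U a x → Forces M χ U a x) →
                  GForces φ U a → GForces ψ U a → GForces χ U a
    gForces-zip f (V , V∈ , p , h) (W , W∈ , _ , k) =
      V ⊓ W , ⊓-closed V∈ W∈ , ⊑-trans ⊓⊑ˡ p ,
      λ x (x∈V , x∈W) → f (h x x∈V) (k x x∈W)

  -- The two witnessing members of the filter would have an empty intersection, which nontriviality
  -- forbids.
  gForces-¬⁻ : ∀ {n} (φ : Formula n) {U} {a : Vector (Sec.Carrier U) n} →
               GForces (¬′ φ) U a → ¬ GForces φ U a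
  gForces-¬⁻ φ (V , V∈ , _ , h) (W , W∈ , _ , k) =
    nontrivial (V ⊓ W) (λ x (x∈V , x∈W) → forces-¬⁻ φ (h x x∈V) (k x x∈W))
      (⊓-closed V∈ W∈)

  module _ {n : ℕ} (φ : Formula n) {U : Open} (U∈ : U ∈ 𝔽) {a : Vector (Sec.Carrier U) n} where

    gForces-¬⁺ : ¬ GForces φ U a → GForces (¬′ φ) U a
    gForces-¬⁺ h with gForces-decide φ U∈ a
    ... | inj₁ k = ⊥-elim (h k)
    ... | inj₂ k = k

    -- Proof by contradiction is constructive here, since genericity supplies the case distinction.
    gForces-raa : ¬ GForces (¬′ φ) U a → GForces φ U a
    gForces-raa h with gForces-decide φ U∈ a
    ... | inj₁ k = k
    ... | inj₂ k = ⊥-elim (h k)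

  gForces-⇒⁻ : ∀ {n} (φ ψ : Formula n) {U} {a : Vector (Sec.Carrier U) n} →
               GForces (φ ⇒′ ψ) U a → GForces φ U a → GForces ψ U a
  gForces-⇒⁻ φ ψ = gForces-zip {φ = φ ⇒′ ψ} {φ} {χ = ψ} λ (_ , x∈V , _ , f) → f _ x∈V

  -- Material implication: once `φ` is decided, either `ψ` is forced outright or the premise is
  -- refuted.
  gForces-⇒⁺ : ∀ {n} (φ ψ : Formula n) {U} → U ∈ 𝔽 → {a : Vector (Sec.Carrier U) n} →
               (GForces φ U a → GForces ψ U a) → GForces (φ ⇒′ ψ) U a
  gForces-⇒⁺ φ ψ U∈ {a} h with gForces-decide φ U∈ a
  ... | inj₁ k = let (V , V∈ , p , f) = h k
                 in V , V∈ , p , λ x x∈V → V , x∈V , p , λ y y∈V _ → f y y∈V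
  ... | inj₂ k = gForces-map {φ = ¬′ φ} {φ ⇒′ ψ}
                   (λ (V , x∈V , p , f) → V , x∈V , p , λ y y∈V → ⊥-elim ∘ f y y∈V) k

  gForces-∀⁻ : ∀ {n} (φ : Formula (ℕ.suc n)) {U} {a : Vector (Sec.Carrier U) n} →
               GForces (∀′ φ) U a → ∀ {W} → W ∈ 𝔽 → (p : W ⊑ U) (b : Sec.Carrier W) →
               GForces φ W (b ∷ a ↾ p)
  gForces-∀⁻ φ {a = a} (V , V∈ , _ , h) {W} W∈ p b =
    V ⊓ W , ⊓-closed V∈ W∈ , ⊓⊑ʳ , λ x (x∈V , x∈W) → forces-∀⁻ φ a (h x x∈V) p x∈W b

  gForces-∃⁻ : ∀ {n} (φ : Formula (ℕ.suc n)) {U} → U ∈ 𝔽 →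
               {a : Vector (Sec.Carrier U) n} → GForces (∃′ φ) U a →
               ∃ λ W → W ∈ 𝔽 × Σ (W ⊑ U) λ p → ∃ λ b → GForces φ W (b ∷ a ↾ p)
  gForces-∃⁻ φ U∈ {a} h =
    let (V , V∈ , p , k)      = gForces⇒openForces (∃′ φ) h
        -- `∃^ 1 φ` computes to `∃′ φ`, and the witness comes as a vector of length one; `e`
        -- replaces `b ++ _` by `b zero ∷ _` and merges the two restrictions.
        (W , W∈ , q , b , k′) = witnesses 1 φ V V∈ (a ↾ p) k
        r = ⊑-trans q p
        e : Agree ⊑-refl ⊑-refl (b ++ ((a ↾ p) ↾ q)) (b zero ∷ a ↾ r)
        e = λ { zero     → Sec.refl W
              ; (fsuc i) → GMorphism.cong (ρ ⊑-refl) (ρ-comp q p r (a i)) }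
    in W , W∈ , r , b zero , W , W∈ , ⊑-refl ,
       λ x x∈W → forces-germ φ ⊑-refl ⊑-refl _ _ e x∈W (k′ x x∈W)

  -- If `¬′ ∃′ φ` were generically forced, so would be `∀′ ¬′ φ`; hence `∃′ φ` is, and genericity
  -- yields a witness.
  gForces-¬∀¬⁻ : ∀ {n} (φ : Formula (ℕ.suc n)) → positive φ ≡ false → ∀ {U} → U ∈ 𝔽 →
                 {a : Vector (Sec.Carrier U) n} → GForces (¬′ ∀′ ¬′ φ) U a →
                 ∃ λ W → W ∈ 𝔽 × Σ (W ⊑ U) λ p → ∃ λ b → GForces φ W (b ∷ a ↾ p)
  gForces-¬∀¬⁻ φ - {U} U∈ {a} h = gForces-∃⁻ φ U∈ (gForces-raa (∃′ φ) U∈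
    (gForces-¬⁻ (∀′ ¬′ φ) h ∘ gForces-map {φ = ¬′ ∃′ φ} {∀′ ¬′ φ} (¬∃⇒∀¬ φ - U a)))

  -- Stability is assumed because excluding a counterexample only gives the universal formula with a
  -- doubly negated body.
  gForces-∀⁺ : ∀ {n} (φ : Formula (ℕ.suc n)) →
               (∀ W (b : Vector (Sec.Carrier W) (ℕ.suc n)) {y} →
                 Forces M (¬′ ¬′ φ) W b y → Forces M φ W b y) →
               ∀ {U} → U ∈ 𝔽 → {a : Vector (Sec.Carrier U) n} →
               (∀ {W} → W ∈ 𝔽 → (p : W ⊑ U) (b : Sec.Carrier W) →
                 GForces φ W (b ∷ a ↾ p)) →
               GForces (∀′ φ) U a
  gForces-∀⁺ φ stable {U} U∈ {a} h with gForces-decide (∃′ ¬′ φ) U∈ a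
  ... | inj₁ k = let (W , W∈ , p , b , k′) = gForces-∃⁻ (¬′ φ) U∈ k
                 in ⊥-elim (gForces-¬⁻ φ k′ (h W∈ p b))
  ... | inj₂ k = gForces-map {φ = ¬′ ∃′ ¬′ φ} {∀′ φ}
                   (∀-mono (¬′ ¬′ φ) φ U a stable ∘ ¬∃⇒∀¬ (¬′ φ) refl U a) k

  -- Germs of tuples and values of terms.

  germs-↾ : ∀ {n U V} (U∈ : U ∈ 𝔽) (V∈ : V ∈ 𝔽) (p : V ⊑ U)
            (a : Vector (Sec.Carrier U) n) → ∀ i → germs V∈ (a ↾ p) i ∼ germs U∈ a i
  germs-↾ {V = V} U∈ V∈ p a i = V , V∈ , ⊑-refl , p , ρ-id ⊑-refl (res p (a i))

  -- Brings an arbitrary germ `x` and the tuple `a` to a common domain for the quantifier cases.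
  germs-∷ : ∀ {n U V} (U∈ : U ∈ 𝔽) (V∈ : V ∈ 𝔽) (p : V ⊑ U) (x : Germ) (q : V ⊑ dom x)
            (a : Vector (Sec.Carrier U) n) →
            ∀ i → germs V∈ (res q (sec x) ∷ a ↾ p) i ∼ (x ∷ germs U∈ a) i
  germs-∷ {V = V} U∈ V∈ p x q a zero     = V , V∈ , ⊑-refl , q , ρ-id ⊑-refl _
  germs-∷ U∈ V∈ p x q a (fsuc i) = germs-↾ U∈ V∈ p a i

  evalGerm : ∀ {n U} → U ∈ 𝔽 → Vector (Sec.Carrier U) n → Term n → Germ
  evalGerm {U = U} U∈ a t = mkGerm U U∈ (Semantics.eval (Sec.structure U) t a)

  eval-germs : ∀ {n U} (U∈ : U ∈ 𝔽) (t : Term n) (a : Vector (Sec.Carrier U) n) →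
               eval t (germs U∈ a) ∼ evalGerm U∈ a t
  eval-germs U∈ (var i) a = ∼-refl {germs U∈ a i}
  eval-germs {U = U} U∈ (con c) a =
    -- Constants of the generic model are germs over `whole`; `incl _` is the inclusion of `U` in
    -- it.
    U , U∈ , incl _ , ⊑-refl ,
    Sec.trans U (GMorphism.con-homo (ρ (incl _)) c)
                (Sec.sym U (GMorphism.con-homo (ρ ⊑-refl) c))
  eval-germs {U = U} U∈ (fun f ts) a =
    ∼-trans {funᵍ f xs} {funᵍ f ys} {evalGerm U∈ a (fun f ts)}
      (funᵍ-cong f {xs} {ys} λ i → eval-germs U∈ (ts i) a)
      (∼-trans {funᵍ f ys} {mkGerm U U∈ (Sec.funᴵ U f (λ i → res ⊑-refl (sec (ys i))))}
               {evalGerm U∈ a (fun f ts)}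
        (funᵍ-rep f {ys} U∈ (λ _ → ⊑-refl))
        (≈⇒∼ U∈ U∈ (Sec.funᴵ-cong U f λ i → ρ-id ⊑-refl _)))
    where
    xs ys : Vector Germ _
    xs i = eval (ts i) (germs U∈ a)
    ys i = evalGerm U∈ a (ts i)

  -- Atomic formulas in the generic model.

  gForces-≈⁺ : ∀ {n} (t u : Term n) {U} (U∈ : U ∈ 𝔽) (a : Vector (Sec.Carrier U) n) →
               genericStructure ⊨ t ≈′ u [ germs U∈ a ] → GForces (t ≈′ u) U a
  gForces-≈⁺ t u {U} U∈ a h =
    let (W , W∈ , p , q , e) =
          ∼-trans {ev t} {eval t (germs U∈ a)} {ev u}
            (∼-sym {eval t (germs U∈ a)} {ev t} (eval-germs U∈ t a))
            (∼-trans {eval t (germs U∈ a)} {eval u (germs U∈ a)} {ev u}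
              h (eval-germs U∈ u a))
    in W , W∈ , p , λ x x∈W → W , x∈W , p ,
       Sec.trans W (Sec.sym W (eval-homo (ρ p) t λ i → Sec.refl W))
         (Sec.trans W e (eval-homo (ρ q) u λ i → res-irr q p (a i)))
    where
    ev = evalGerm U∈ a

  gForces-≈⁻ : ∀ {n} (t u : Term n) {U} (U∈ : U ∈ 𝔽) (a : Vector (Sec.Carrier U) n) →
               GForces (t ≈′ u) U a → genericStructure ⊨ t ≈′ u [ germs U∈ a ]
  gForces-≈⁻ t u U∈ a h =
    let (V , V∈ , p , k) = gForces⇒openForces (t ≈′ u) h
        ev = evalGerm V∈ (a ↾ p)
        b  = germs V∈ (a ↾ p)
    in ⊨-cong genericStructure (t ≈′ u) (germs-↾ U∈ V∈ p a)
         (∼-trans {eval t b} {ev t} {eval u b} (eval-germs V∈ t (a ↾ p))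
           (∼-trans {ev t} {ev u} {eval u b} (≈⇒∼ V∈ V∈ (glue-≈ sheaf t u k))
             (∼-sym {eval u b} {ev u} (eval-germs V∈ u (a ↾ p)))))

  gForces-rel⁺ : ∀ {n} R (ts : Vector (Term n) (Language.relArity L R))
                 {U} (U∈ : U ∈ 𝔽) (a : Vector (Sec.Carrier U) n) →
                 genericStructure ⊨ rel R ts [ germs U∈ a ] → GForces (rel R ts) U a
  gForces-rel⁺ R ts {U} U∈ a (W , W∈ , ys , ys∼ , h) =
    D , D∈ , p , λ x x∈D → D , x∈D , p ,
      Sec.relᴵ-resp D R
        (λ i → let (_ , _ , _ , _ , e≈) = e i in
          Sec.trans D (shrink (D⊑ i) e≈ q p) (eval-homo (ρ p) (ts i) λ j → Sec.refl D))
        (GMorphism.rel-homo (ρ q) R ys h)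
    where
    e : ∀ i → mkGerm W W∈ (ys i) ∼ evalGerm U∈ a (ts i)
    e i = ∼-trans {mkGerm W W∈ (ys i)} {eval (ts i) (germs U∈ a)} {evalGerm U∈ a (ts i)}
            (ys∼ i) (eval-germs U∈ (ts i) a)
    D : Open
    -- Each component of `ys` agrees with its term on its own member of the filter; there are
    -- finitely many, so all agree on `D`.
    D = W ⊓ U ⊓ ⨅ (proj₁ ∘ e)
    D∈ : D ∈ 𝔽
    D∈ = ⊓-closed W∈ (⊓-closed U∈ (⨅∈𝔽 (proj₁ ∘ e) λ i → proj₁ (proj₂ (e i))))
    D⊑ : ∀ i → D ⊑ proj₁ (e i)
    D⊑ i = ⊑-trans (⊑-trans ⊓⊑ʳ ⊓⊑ʳ) (⨅⊑ (proj₁ ∘ e) i)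
    p : D ⊑ U
    p = ⊑-trans ⊓⊑ʳ ⊓⊑ˡ
    q : D ⊑ W
    q = ⊓⊑ˡ

  gForces-rel⁻ : ∀ {n} R (ts : Vector (Term n) (Language.relArity L R))
                 {U} (U∈ : U ∈ 𝔽) (a : Vector (Sec.Carrier U) n) →
                 GForces (rel R ts) U a → genericStructure ⊨ rel R ts [ germs U∈ a ]
  gForces-rel⁻ R ts U∈ a h =
    let (V , V∈ , p , k) = gForces⇒openForces (rel R ts) h
        b = germs V∈ (a ↾ p)
    in ⊨-cong genericStructure (rel R ts) (germs-↾ U∈ V∈ p a)
         ( V , V∈ , _
         , (λ i → ∼-sym {eval (ts i) b} {evalGerm V∈ (a ↾ p) (ts i)}
                    (eval-germs V∈ (ts i) (a ↾ p)))
         , glue-rel sheaf R ts k)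

  -- Truth in the generic model and forcing of the translation, by induction on formulas.

  true⇒gForces : ∀ {n} (φ : Formula n) {U} (U∈ : U ∈ 𝔽) (a : Vector (Sec.Carrier U) n) →
                 genericStructure ⊨ φ [ germs U∈ a ] → GForces (gödel φ) U a
  -- Mutually recursive with `true⇒gForces`, since negations and premises of implications reverse
  -- the direction.
  gForces⇒true : ∀ {n} (φ : Formula n) {U} (U∈ : U ∈ 𝔽) (a : Vector (Sec.Carrier U) n) →
                 GForces (gödel φ) U a → genericStructure ⊨ φ [ germs U∈ a ]

  true⇒gForces (t ≈′ u) U∈ a h =
    gForces-map {φ = t ≈′ u} {gödel (t ≈′ u)} (¬¬-intro (t ≈′ u)) (gForces-≈⁺ t u U∈ a h)
  true⇒gForces (rel R ts) U∈ a h =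
    gForces-map {φ = rel R ts} {gödel (rel R ts)} (¬¬-intro (rel R ts))
      (gForces-rel⁺ R ts U∈ a h)
  true⇒gForces (¬′ φ) U∈ a h = gForces-¬⁺ (gödel φ) U∈ (h ∘ gForces⇒true φ U∈ a)
  true⇒gForces (φ ∧′ ψ) U∈ a (h , k) =
    gForces-zip {φ = gödel φ} {gödel ψ} {χ = gödel (φ ∧′ ψ)}
      (forces-∧⁺ (gödel φ) (gödel ψ) (gödel-nonpositive φ))
      (true⇒gForces φ U∈ a h) (true⇒gForces ψ U∈ a k)
  -- A conjunction of negations is nonpositive by computation, so forcing it is literally a pair, to
  -- which `proj₁` applies.
  true⇒gForces (φ ∨′ ψ) U∈ a (inj₁ h) =
    gForces-¬⁺ (¬′ gödel φ ∧′ ¬′ gödel ψ) U∈ λ k →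
      gForces-¬⁻ (gödel φ) (gForces-map {φ = ¬′ gödel φ ∧′ ¬′ gödel ψ} {¬′ gödel φ} proj₁ k)
        (true⇒gForces φ U∈ a h)
  true⇒gForces (φ ∨′ ψ) U∈ a (inj₂ h) =
    gForces-¬⁺ (¬′ gödel φ ∧′ ¬′ gödel ψ) U∈ λ k →
      gForces-¬⁻ (gödel ψ) (gForces-map {φ = ¬′ gödel φ ∧′ ¬′ gödel ψ} {¬′ gödel ψ} proj₂ k)
        (true⇒gForces ψ U∈ a h)
  true⇒gForces (φ ⇒′ ψ) U∈ a h =
    gForces-⇒⁺ (gödel φ) (gödel ψ) U∈ (true⇒gForces ψ U∈ a ∘ h ∘ gForces⇒true φ U∈ a)
  true⇒gForces (∀′ φ) U∈ a h =
    gForces-∀⁺ (gödel φ) (gödel-stable φ) U∈ λ {W} W∈ p b →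
      true⇒gForces φ W∈ (b ∷ a ↾ p)
        (⊨-cong genericStructure φ
          (λ { zero     → ∼-refl {mkGerm W W∈ b}
             ; (fsuc i) → ∼-sym {germs W∈ (a ↾ p) i} {germs U∈ a i} (germs-↾ U∈ W∈ p a i) })
          (h (mkGerm W W∈ b)))
  -- The witness `x` has its own domain, so it is compared with `a` over `dom x ⊓ U`, where it
  -- contradicts the forced `∀′ ¬′ gödel φ`.
  true⇒gForces (∃′ φ) {U} U∈ a (x , h) =
    gForces-¬⁺ (∀′ ¬′ gödel φ) U∈ λ k →
      gForces-¬⁻ (gödel φ) (gForces-∀⁻ (¬′ gödel φ) k D∈ ⊓⊑ʳ (res ⊓⊑ˡ (sec x)))
        (true⇒gForces φ D∈ b
          (⊨-cong genericStructure φ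
            (λ i → ∼-sym {germs D∈ b i} {(x ∷ germs U∈ a) i}
                     (germs-∷ U∈ D∈ ⊓⊑ʳ x ⊓⊑ˡ a i)) h))
    where
    D∈ : dom x ⊓ U ∈ 𝔽
    D∈ = ⊓-closed (dom∈𝔽 x) U∈
    b : Vector (Sec.Carrier (dom x ⊓ U)) _
    b = res ⊓⊑ˡ (sec x) ∷ a ↾ ⊓⊑ʳ

  gForces⇒true (t ≈′ u) U∈ a h =
    gForces-≈⁻ t u U∈ a (gForces-raa (t ≈′ u) U∈ (gForces-¬⁻ (¬′ (t ≈′ u)) h))
  gForces⇒true (rel R ts) U∈ a h =
    gForces-rel⁻ R ts U∈ a (gForces-raa (rel R ts) U∈ (gForces-¬⁻ (¬′ rel R ts) h))
  gForces⇒true (¬′ φ) U∈ a h = gForces-¬⁻ (gödel φ) h ∘ true⇒gForces φ U∈ a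
  gForces⇒true (φ ∧′ ψ) U∈ a h =
    gForces⇒true φ U∈ a (gForces-map {φ = gödel (φ ∧′ ψ)} {gödel φ}
      (proj₁ ∘ forces-∧⁻ (gödel φ) (gödel ψ) (gödel-nonpositive φ)) h) ,
    gForces⇒true ψ U∈ a (gForces-map {φ = gödel (φ ∧′ ψ)} {gödel ψ}
      (proj₂ ∘ forces-∧⁻ (gödel φ) (gödel ψ) (gödel-nonpositive φ)) h)
  -- Deciding both translations shows which disjunct is true; refuting both contradicts `h`.
  gForces⇒true (φ ∨′ ψ) U∈ a h
    with gForces-decide (gödel φ) U∈ a | gForces-decide (gödel ψ) U∈ a
  ... | inj₁ k | _      = inj₁ (gForces⇒true φ U∈ a k)
  ... | inj₂ _ | inj₁ k = inj₂ (gForces⇒true ψ U∈ a k)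
  ... | inj₂ k | inj₂ l =
    ⊥-elim (gForces-¬⁻ (¬′ gödel φ ∧′ ¬′ gödel ψ) h
      (gForces-zip {φ = ¬′ gödel φ} {¬′ gödel ψ} {χ = ¬′ gödel φ ∧′ ¬′ gödel ψ} _,_ k l))
  gForces⇒true (φ ⇒′ ψ) U∈ a h =
    gForces⇒true ψ U∈ a ∘ gForces-⇒⁻ (gödel φ) (gödel ψ) h ∘ true⇒gForces φ U∈ a
  gForces⇒true (∀′ φ) {U} U∈ a h x =
    ⊨-cong genericStructure φ (germs-∷ U∈ D∈ ⊓⊑ʳ x ⊓⊑ˡ a)
      (gForces⇒true φ D∈ _ (gForces-∀⁻ (gödel φ) h D∈ ⊓⊑ʳ (res ⊓⊑ˡ (sec x))))
    where
    D∈ : dom x ⊓ U ∈ 𝔽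
    D∈ = ⊓-closed (dom∈𝔽 x) U∈
  gForces⇒true (∃′ φ) U∈ a h =
    let (W , W∈ , p , b , k) = gForces-¬∀¬⁻ (gödel φ) (gödel-nonpositive φ) U∈ h
    in mkGerm W W∈ b ,
       ⊨-cong genericStructure φ
         (λ { zero     → ∼-refl {mkGerm W W∈ b}
            ; (fsuc i) → germs-↾ U∈ W∈ p a i })
         (gForces⇒true φ W∈ (b ∷ a ↾ p) k)

  -- The set of forced points is open and contains the witnessing member of the filter, so upward
  -- closure puts it in `𝔽`; conversely, it can serve as that member.
  gForces⇔forcedSet∈ : ∀ {n} (φ : Formula n) U (a : Vector (Sec.Carrier U) n) →
                       GForces φ U a ⇔
                       (∃ λ W → W ∈ 𝔽 ×
                         points W ≐′ (λ x → x ∈ points U × Forces M φ U a x))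
  gForces⇔forcedSet∈ φ U a = mk⇔
    (λ (V , V∈ , _ , h) → let (W , W⊆ , ⊆W) = forcedSet φ U a in
      W , ⊑-closed (incl λ x x∈V → ⊆W x (h x x∈V)) V∈ ,
      (λ x x∈W → forces⇒∈ φ U a (W⊆ x x∈W) , W⊆ x x∈W) , (λ x (_ , k) → ⊆W x k))
    (λ (W , W∈ , W⊆ , _) →
      W , W∈ , incl (λ x → proj₁ ∘ W⊆ x) , λ x → proj₂ ∘ W⊆ x)

theorem4p3p3 :
    ∀ {ℓ : Level} (G : Group ℓ ℓ) (L : Language ℓ) (X : TopologicalSpace ℓ) →
    let open TopologicalSpace X
        open Syntax L in
    (M : Presheaf G L X) → IsSheaf M →
    let open Presheaf M in
    (𝔽 : Pred Open (suc ℓ)) (generic : IsGeneric M 𝔽) →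
    let open GenericModel M (IsGeneric.isFilter generic)
        open GStructure genericModel using () renaming (structure to Mᵍᵉⁿ) in
    ∀ {n : ℕ} (φ : Formula n) (U : Open) (U∈𝔽 : U ∈ 𝔽)
      (a : Vector (Sec.Carrier U) n) →
    let [1] = Mᵍᵉⁿ ⊨ φ [ germs U∈𝔽 a ]
        [2] = ∃ λ V → V ∈ 𝔽 × Σ (V ⊑ U) λ p → OpenForces M (gödel φ) V (a ↾ p)
        [3] = ∃ λ W → W ∈ 𝔽 ×
                points W ≐′ (λ x → x ∈ points U × Forces M (gödel φ) U a x) in
    ([1] ⇔ [2]) × ([2] ⇔ [3])
theorem4p3p3 G L X M sheaf 𝔽 generic φ U U∈𝔽 a =
  mk⇔ (gForces⇒openForces (gödel φ) ∘ true⇒gForces φ U∈𝔽 a)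
      (gForces⇒true φ U∈𝔽 a ∘ openForces⇒gForces (gödel φ)) ,
  mk⇔ (Equivalence.to set ∘ openForces⇒gForces (gödel φ))
      (gForces⇒openForces (gödel φ) ∘ Equivalence.from set)
  where
  open Syntax L using (gödel)
  open Genericity M sheaf 𝔽 generic
  set = gForces⇔forcedSet∈ (gödel φ) U a
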